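{- Let $n$ and $b$ be integers with $1\le b<\frac{n}{2}-1$, and let $BT\in\mathcal{CT}^*_{n,b}$. Then \[ M_1(BT)\le\begin{cases}2(2n+3b-3) & \text{if } 1\le b<\frac{n-2}{3},\\ 2(4n-3b-7) & \text{if } \frac{n-2}{3}\le b<\frac{n}{2}-1.\end{cases} \] For $1\le b<\frac{n-2}{3}$, equality holds if and only if $BT$ has degree sequence consisting of $b$ entries $4$, $n-3b-2$ entries $2$ and $2b+2$ entries $1$. For $\frac{n-2}{3}\le b<\frac{n}{2}-1$, equality holds if and only if $BT$ has degree sequence consisting of $n-2b-2$ entries $4$, $3b-n+2$ entries $3$ and $n-b$ entries $1$.
   Context: A chemical tree is a tree with maximum degree at most $4$. A branching vertex is a vertex of degree greater than $2$. $\mathcal{CT}^*_{n,b}$ denotes the class of all $n$-vertex chemical trees with exactly $b$ branching vertices. The first Zagreb index is $M_1(G)=\sum_{v\in V(G)}d_v^2$, where $d_v$ is the degree of $v$. -}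

module Defs where

open import Level using (0ℓ)
open import Data.Fin using (Fin)
open import Data.List using (List; _∷_; _∷ʳ_; length; map; filter; allFin)
open import Data.List.Relation.Unary.Linked using (Linked)
open import Data.List.Relation.Unary.Unique.Propositional using (Unique)
open import Data.Nat using (ℕ; _≤_; _<_; _<?_; _^_)
open import Data.Nat.ListAction using (sum)
open import Data.Product using (_×_)
open import Relation.Binary.Core using (Rel)
open import Relation.Binary.Construct.Closure.ReflexiveTransitive using (Star)
open import Relation.Binary.Definitions using (Decidable; Symmetric)
open import Relation.Binary.PropositionalEquality using (_≡_)
open import Relation.Nullary using (¬_; Dec)

-- Finite simple graphs on the vertex set Fin n.
record Graph (n : ℕ) : Set₁ where
  field
    Adj        : Rel (Fin n) 0ℓ
    adj?       : Decidable Adj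
    adj-sym    : Symmetric Adj
    adj-irrefl : ∀ {v} → ¬ Adj v v

module _ {n : ℕ} (G : Graph n) where
  open Graph G

  degree : Fin n → ℕ
  degree v = length (filter (adj? v) (allFin n))

  degreeSequence : List ℕ
  degreeSequence = map degree (allFin n)

  M₁ : ℕ
  M₁ = sum (map (λ v → degree v ^ 2) (allFin n))

  Connected : Set
  Connected = ∀ u v → Star Adj u v

  -- The cycle v, vs₁, …, vsₖ, v: at least three vertices, all distinct,
  -- consecutive ones adjacent, and the last one adjacent to v.
  IsCycle : Fin n → List (Fin n) → Set
  IsCycle v vs = 2 ≤ length vs × Unique (v ∷ vs) × Linked Adj (v ∷ (vs ∷ʳ v))

  Acyclic : Set
  Acyclic = ∀ v vs → ¬ IsCycle v vs

  IsTree : Set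
  IsTree = Connected × Acyclic

  IsChemicalTree : Set
  IsChemicalTree = IsTree × (∀ v → degree v ≤ 4)

  Branching : Fin n → Set
  Branching v = 2 < degree v

  branching? : ∀ v → Dec (Branching v)
  branching? v = 2 <? degree v

  branchingCount : ℕ
  branchingCount = length (filter branching? (allFin n))

-- CT* n b G says that G belongs to the class 𝒞𝒯*ₙ,ᵦ.
CT* : (n b : ℕ) → Graph n → Set
CT* n b G = IsChemicalTree G × branchingCount G ≡ b

{-# OPTIONS --safe #-}
-- A tree can be built from a root by attaching one vertex at a time; acyclicity
-- makes the new vertex adjacent to exactly one earlier vertex, so the degrees
-- sum to 2(n − 1). If nᵢ vertices have degree i, then counting vertices,
-- branching vertices and edges gives
--   M₁ = 2(2n + 3b − 3) − 4 n₃ = 2(4n − 3b − 7) − 4 n₂,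
-- and the degree sequence is determined by n, b and either of n₂ and n₃.
module Submission where

open import Defs
open import Data.Bool using (if_then_else_)
open import Data.Fin using (Fin; zero; suc)
open import Data.List using (List; []; _∷_; _∷ʳ_; length; map; filter; allFin; replicate; _++_)
open import Data.List.Membership.Propositional using (_∈_; _∉_)
open import Data.List.Membership.Propositional.Properties using (∈-allFin; ∈-filter⁺; ∈-filter⁻; ∈-length)
open import Data.List.Membership.Propositional.Properties.WithK using (unique∧set⇒bag)
open import Data.List.Properties using (map-∘; map-cong; length-tabulate)
open import Data.List.Relation.Binary.BagAndSetEquality using (∼bag⇒↭)
open import Data.List.Relation.Binary.Permutation.Propositional using (_↭_; ↭-refl; ↭-trans; ↭-sym; prep)
open import Data.List.Relation.Binary.Permutation.Propositional.Properties using (map⁺; filter-↭; ↭-length; ++⁺ˡ; shift)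
open import Data.List.Relation.Binary.Subset.Propositional using (_⊆_)
open import Data.List.Relation.Unary.All as All using (All; []; _∷_)
open import Data.List.Relation.Unary.All.Properties using (All¬⇒¬Any; ¬Any⇒All¬; ∷ʳ⁺)
  renaming (map⁺ to All-map⁺)
open import Data.List.Relation.Unary.Any using (here; there)
open import Data.List.Relation.Unary.Linked using (Linked; [-]; _∷_)
open import Data.List.Relation.Unary.Unique.Propositional using (Unique; []; _∷_)
open import Data.List.Relation.Unary.Unique.Propositional.Properties using (allFin⁺; filter⁺)
open import Data.Nat using (ℕ; zero; suc; _+_; _*_; _∸_; _^_; _≤_; _<_; z≤n; s≤s; _<?_)
open import Data.Nat.ListAction using (sum)
open import Data.Nat.ListAction.Properties using (sum-↭)
open import Data.Nat.Properties
  using (≤-antisym; +-assoc; +-cancelˡ-≡; +-identityʳ; m+n∸m≡n; m≤m+n; m+n≡0⇒m≡0; ≤-trans; ≤-reflexive; m≤n+m)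
open import Data.Nat.Tactic.RingSolver using (solve-∀)
open import Data.Product using (_×_; _,_; ∃-syntax)
open import Function.Base using (_∘_; _$_)
open import Function.Bundles using (_⇔_; mk⇔)
open import Relation.Binary.Construct.Closure.ReflexiveTransitive using (Star; ε; _◅_)
open import Relation.Binary.PropositionalEquality
  using (_≡_; _≢_; refl; sym; trans; cong; cong₂; subst; module ≡-Reasoning)
open import Relation.Nullary using (does; yes; no; ¬_; contradiction)
open import Relation.Unary using (Decidable)
import Data.Fin.Properties as Fin
import Data.List.Membership.DecPropositional as DecMembership

private
  variable
    A : Set
    n : ℕ

-- Counting and summing over lists.

indicator : {P : A → Set} → Decidable P → A → ℕ
indicator P? x = if does (P? x) then 1 else 0

length-filter≡sum : {P : A → Set} (P? : Decidable P) (xs : List A) →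
  length (filter P? xs) ≡ sum (map (indicator P?) xs)
length-filter≡sum P? [] = refl
length-filter≡sum P? (x ∷ xs) with P? x
... | yes _ = cong suc (length-filter≡sum P? xs)
... | no  _ = length-filter≡sum P? xs

sum-map-+ : (f g : A → ℕ) (xs : List A) →
  sum (map (λ x → f x + g x) xs) ≡ sum (map f xs) + sum (map g xs)
sum-map-+ f g [] = refl
sum-map-+ f g (x ∷ xs) = trans (cong (f x + g x +_) (sum-map-+ f g xs))
  (interchange (f x) (g x) (sum (map f xs)) (sum (map g xs)))
  where
  interchange : ∀ p q r s → p + q + (r + s) ≡ p + r + (q + s)
  interchange = solve-∀

sum-map-replicate-++ : (f : A → ℕ) (k : ℕ) (x : A) (xs : List A) →
  sum (map f (replicate k x ++ xs)) ≡ k * f x + sum (map f xs)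
sum-map-replicate-++ f zero    x xs = refl
sum-map-replicate-++ f (suc k) x xs =
  trans (cong (f x +_) (sum-map-replicate-++ f k x xs)) (sym (+-assoc (f x) (k * f x) _))

length≡sum : (xs : List A) → length xs ≡ sum (map (λ _ → 1) xs)
length≡sum []       = refl
length≡sum (_ ∷ xs) = cong suc (length≡sum xs)

-- The hypothesis is doubly negated because acyclicity can only refute a pair of distinct
-- neighbours.
unique⇒length≤1 : {xs : List A} → Unique xs →
  (∀ {x y} → x ∈ xs → y ∈ xs → ¬ x ≢ y) → length xs ≤ 1
unique⇒length≤1 []        _ = z≤n
unique⇒length≤1 (_ ∷ [])  _ = s≤s z≤n
unique⇒length≤1 ((x≢y ∷ _) ∷ _ ∷ _) eq =
  contradiction x≢y (eq (here refl) (there (here refl)))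

-- Simple paths and trees grown from a root.

module _ (G : Graph n) where
  open Graph G
  open DecMembership (Fin._≟_ {n}) using (_∈?_)

  -- The index lists all vertices, both ends included, so that it can serve directly as the `vs` of
  -- `IsCycle`.
  data Path : Fin n → Fin n → List (Fin n) → Set where
    [_] : ∀ u → Path u u (u ∷ [])
    cons : ∀ {u x w xs} → Adj u x → u ∉ xs → Path x w xs → Path u w (u ∷ xs)

  snoc : ∀ {u w v xs} → Path u w xs → Adj w v → v ∉ xs → Path u v (xs ∷ʳ v)
  snoc [ u ] e v∉ = cons e (λ { (here refl) → v∉ (here refl) }) [ _ ]
  snoc {v = v} (cons e u∉ p) e′ v∉ = cons e u∉′ (snoc p e′ (v∉ ∘ there))
    where
    u∉′ = All¬⇒¬Any (∷ʳ⁺ (¬Any⇒All¬ _ u∉) (λ { refl → v∉ (here refl) }))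

  Path⇒Unique : ∀ {u w xs} → Path u w xs → Unique xs
  Path⇒Unique [ u ]         = [] ∷ []
  Path⇒Unique (cons _ u∉ p) = ¬Any⇒All¬ _ u∉ ∷ Path⇒Unique p

  -- A cycle needs only `z` equal to `v`, but the recursion moves `v` along the path while `z` stays
  -- fixed.
  Path⇒Linked : ∀ {v u w z xs} → Adj v u → Path u w xs → Adj w z →
    Linked Adj (v ∷ (xs ∷ʳ z))
  Path⇒Linked vu [ u ]        wz = vu ∷ wz ∷ [-]
  Path⇒Linked vu (cons e _ p) wz = vu ∷ Path⇒Linked e p wz

  Path⇒2≤length : ∀ {u w xs} → u ≢ w → Path u w xs → 2 ≤ length xs
  Path⇒2≤length u≢w [ u ]                  = contradiction refl u≢w
  Path⇒2≤length u≢w (cons _ _ [ _ ])       = s≤s (s≤s z≤n)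
  Path⇒2≤length u≢w (cons _ _ (cons _ _ _)) = s≤s (s≤s z≤n)

  -- Newest vertex first. Only one neighbour `u` is recorded at each attachment; that it is the sole
  -- one is derived later from acyclicity.
  data Grown : List (Fin n) → Set where
    root : ∀ r → Grown (r ∷ [])
    grow : ∀ {S u v} → Grown S → u ∈ S → v ∉ S → Adj u v → Grown (v ∷ S)

  Grown⇒Unique : ∀ {S} → Grown S → Unique S
  Grown⇒Unique (root r)        = [] ∷ []
  Grown⇒Unique (grow g _ v∉ _) = ¬Any⇒All¬ _ v∉ ∷ Grown⇒Unique g

  -- An end that is the newest vertex is reached through its attaching neighbour. Staying inside `S`
  -- keeps the older part of the path off that vertex, so the path remains simple.
  Grown⇒Path : ∀ {S u w} → Grown S → u ∈ S → w ∈ S → ∃[ xs ] Path u w xs × All (_∈ S) xs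
  Grown⇒Path (root r) (here refl) (here refl) = _ , [ r ] , here refl ∷ []
  Grown⇒Path (grow g u∈ v∉ e) (here refl) (here refl) = _ , [ _ ] , here refl ∷ []
  Grown⇒Path (grow g u∈ v∉ e) (here refl) (there w∈) with Grown⇒Path g u∈ w∈
  ... | xs , p , xs⊆S = _ , cons (adj-sym e) (v∉ ∘ All.lookup xs⊆S) p , here refl ∷ All.map there xs⊆S
  Grown⇒Path (grow g u∈ v∉ e) (there w∈) (here refl) with Grown⇒Path g w∈ u∈
  ... | xs , p , xs⊆S = _ , snoc p e (v∉ ∘ All.lookup xs⊆S) , ∷ʳ⁺ (All.map there xs⊆S) (here refl)
  Grown⇒Path (grow g _ _ _) (there u∈) (there w∈) with Grown⇒Path g u∈ w∈
  ... | xs , p , xs⊆S = xs , p , All.map there xs⊆S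

  -- The degree sum of a tree.

  degreeIn : List (Fin n) → Fin n → ℕ
  degreeIn S v = length (filter (adj? v) S)

  adj-indicator-sym : ∀ u v → indicator (adj? u) v ≡ indicator (adj? v) u
  adj-indicator-sym u v with adj? u v | adj? v u
  ... | yes _ | yes _ = refl
  ... | no  _ | no  _ = refl
  ... | yes e | no ¬e = contradiction (adj-sym e) ¬e
  ... | no ¬e | yes e = contradiction (adj-sym e) ¬e

  degreeIn-∷ : ∀ S v u → degreeIn (v ∷ S) u ≡ indicator (adj? u) v + degreeIn S u
  degreeIn-∷ S v u with adj? u v
  ... | yes _ = refl
  ... | no  _ = refl

  degreeIn-self : ∀ S v → degreeIn (v ∷ S) v ≡ degreeIn S v
  degreeIn-self S v with adj? v v
  ... | yes e = contradiction e adj-irrefl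
  ... | no  _ = refl

  -- Each edge from `v` into `S` counts twice: once at `v` and, by symmetry of adjacency, once at
  -- its other end.
  sum-degreeIn-∷ : ∀ S v → sum (map (degreeIn (v ∷ S)) (v ∷ S)) ≡
    degreeIn S v + (degreeIn S v + sum (map (degreeIn S) S))
  sum-degreeIn-∷ S v = cong₂ _+_ (degreeIn-self S v) $ begin
    sum (map (degreeIn (v ∷ S)) S)
      ≡⟨ cong sum (map-cong (λ u → trans (degreeIn-∷ S v u)
           (cong (_+ degreeIn S u) (adj-indicator-sym u v))) S) ⟩
    sum (map (λ u → indicator (adj? v) u + degreeIn S u) S)
      ≡⟨ sum-map-+ (indicator (adj? v)) (degreeIn S) S ⟩
    sum (map (indicator (adj? v)) S) + sum (map (degreeIn S) S)
      ≡⟨ cong (_+ _) (length-filter≡sum (adj? v) S) ⟨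
    degreeIn S v + sum (map (degreeIn S) S) ∎
    where open ≡-Reasoning

  -- Two earlier neighbours of the new vertex would be joined by a path that
  -- avoids it, and so would close a cycle.
  attach-unique : Acyclic G → ∀ {S u v} → Grown S → u ∈ S → v ∉ S → Adj u v →
    degreeIn S v ≡ 1
  attach-unique acyclic {S} {u} {v} g u∈ v∉ e = ≤-antisym
    (unique⇒length≤1 (filter⁺ (adj? v) (Grown⇒Unique g)) no-two)
    (∈-length (∈-filter⁺ (adj? v) u∈ (adj-sym e)))
    where

    no-two : ∀ {x y} → x ∈ filter (adj? v) S → y ∈ filter (adj? v) S → ¬ x ≢ y
    no-two x∈ y∈ x≢y with ∈-filter⁻ (adj? v) x∈ | ∈-filter⁻ (adj? v) y∈
    ... | x∈S , vx | y∈S , vy with Grown⇒Path g x∈S y∈S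
    ... | xs , p , xs⊆S = acyclic v xs
      ( Path⇒2≤length x≢y p
      , ¬Any⇒All¬ _ (v∉ ∘ All.lookup xs⊆S) ∷ Path⇒Unique p
      , Path⇒Linked vx p (adj-sym vy))

  -- Each attachment adds a single edge, hence 2 to the degree sum; the `+ 2` accounts for the root.
  sum-degreeIn : Acyclic G → ∀ {S} → Grown S → sum (map (degreeIn S) S) + 2 ≡ 2 * length S
  sum-degreeIn acyclic (root r) = cong (λ d → d + 0 + 2) (degreeIn-self [] r)
  sum-degreeIn acyclic (grow {S} {u} {v} g u∈ v∉ e) = begin
    sum (map (degreeIn (v ∷ S)) (v ∷ S)) + 2
      ≡⟨ cong (_+ 2) (sum-degreeIn-∷ S v) ⟩
    degreeIn S v + (degreeIn S v + sum (map (degreeIn S) S)) + 2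
      ≡⟨ cong (λ d → d + (d + sum (map (degreeIn S) S)) + 2) (attach-unique acyclic g u∈ v∉ e) ⟩
    2 + (sum (map (degreeIn S) S) + 2)
      ≡⟨ cong (2 +_) (sum-degreeIn acyclic g) ⟩
    2 + 2 * length S
      ≡⟨ 2+2* (length S) ⟩
    2 * length (v ∷ S) ∎
    where
    open ≡-Reasoning
    2+2* : ∀ m → 2 + 2 * m ≡ 2 * suc m
    2+2* = solve-∀

  -- Exhausting a connected graph.

  -- Follow the walk and attach each vertex not yet present, its predecessor on the walk being the
  -- attaching neighbour.
  grow-along : ∀ {S u w} → Grown S → u ∈ S → Star Adj u w → ∃[ T ] Grown T × S ⊆ T × w ∈ T
  grow-along g u∈ ε = _ , g , (λ x∈ → x∈) , u∈
  grow-along {S} g u∈ (_◅_ {j = x} e es) with x ∈? S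
  ... | yes x∈ = grow-along g x∈ es
  ... | no  x∉ with grow-along (grow g u∈ x∉ e) (here refl) es
  ... | T , g′ , S⊆T , w∈ = T , g′ , S⊆T ∘ there , w∈

  grow-over : Connected G → ∀ {S r} → Grown S → r ∈ S → ∀ ws →
    ∃[ T ] Grown T × S ⊆ T × All (_∈ T) ws
  grow-over conn g r∈ [] = _ , g , (λ x∈ → x∈) , []
  grow-over conn g r∈ (w ∷ ws) with grow-along g r∈ (conn _ w)
  ... | T , g₁ , S⊆T , w∈ with grow-over conn g₁ (S⊆T r∈) ws
  ... | U , g₂ , T⊆U , ws⊆U = U , g₂ , T⊆U ∘ S⊆T , T⊆U w∈ ∷ ws⊆U

  -- Both lists are free of repetitions and contain every vertex, so equality as sets becomes
  -- equality as bags.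
  spanning : Connected G → Fin n → ∃[ T ] Grown T × T ↭ allFin n
  spanning conn r with grow-over conn (root r) (here refl) (allFin n)
  ... | T , g , _ , all∈T = T , g , ∼bag⇒↭ (unique∧set⇒bag (Grown⇒Unique g) (allFin⁺ n)
    (mk⇔ (λ _ → ∈-allFin _) (λ _ → All.lookup all∈T (∈-allFin _))))

  -- The vertex argument starts the growth and rules out the empty graph, where the equation fails.
  -- The permutation acts twice: on the outer sum, and on the list filtered inside each degree.
  sum-degrees : IsTree G → Fin n → sum (degreeSequence G) + 2 ≡ 2 * n
  sum-degrees (conn , acyclic) r with spanning conn r
  ... | T , g , T↭ = begin
    sum (map (degree G) (allFin n)) + 2
      ≡⟨ cong (_+ 2) (sum-↭ (map⁺ (degree G) T↭)) ⟨
    sum (map (degree G) T) + 2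
      ≡⟨ cong (λ ds → sum ds + 2) (map-cong (λ v → ↭-length (filter-↭ (adj? v) T↭)) T) ⟨
    sum (map (degreeIn T) T) + 2
      ≡⟨ sum-degreeIn acyclic g ⟩
    2 * length T
      ≡⟨ cong (2 *_) (trans (↭-length T↭) (length-tabulate {n = n} (λ v → v))) ⟩
    2 * n ∎
    where open ≡-Reasoning

  Star⇒1≤degree : ∀ {v w} → v ≢ w → Star Adj v w → 1 ≤ degree G v
  Star⇒1≤degree v≢w ε = contradiction refl v≢w
  Star⇒1≤degree {v} v≢w (e ◅ _) = ∈-length (∈-filter⁺ (adj? v) (∈-allFin _) e)

-- Degrees from 1 to 4 and their multiplicities.

another-vertex : 2 ≤ n → (v : Fin n) → ∃[ w ] v ≢ w
another-vertex (s≤s (s≤s _)) zero    = suc zero , λ ()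
another-vertex (s≤s (s≤s _)) (suc v) = zero , λ ()

connected⇒1≤degree : (G : Graph n) → 2 ≤ n → Connected G → ∀ v → 1 ≤ degree G v
connected⇒1≤degree G 2≤n conn v with another-vertex 2≤n v
... | w , v≢w = Star⇒1≤degree G v≢w (conn v w)

-- The argument nᵢ is the multiplicity of the degree i.
profile : (n₁ n₂ n₃ n₄ : ℕ) → List ℕ
profile n₁ n₂ n₃ n₄ = replicate n₄ 4 ++ replicate n₃ 3 ++ replicate n₂ 2 ++ replicate n₁ 1

sum-map-profile : ∀ (f : ℕ → ℕ) n₁ n₂ n₃ n₄ → sum (map f (profile n₁ n₂ n₃ n₄)) ≡
  n₄ * f 4 + (n₃ * f 3 + (n₂ * f 2 + n₁ * f 1))
sum-map-profile f n₁ n₂ n₃ n₄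
  rewrite sum-map-replicate-++ f n₄ 4 (replicate n₃ 3 ++ replicate n₂ 2 ++ replicate n₁ 1)
        | sum-map-replicate-++ f n₃ 3 (replicate n₂ 2 ++ replicate n₁ 1)
        | sum-map-replicate-++ f n₂ 2 (replicate n₁ 1)
  = cong (λ s → n₄ * f 4 + (n₃ * f 3 + (n₂ * f 2 + s))) (sum-map-replicate f n₁ 1)
  where
  sum-map-replicate : ∀ (f : ℕ → ℕ) k x → sum (map f (replicate k x)) ≡ k * f x
  sum-map-replicate f zero    x = refl
  sum-map-replicate f (suc k) x = cong (f x +_) (sum-map-replicate f k x)

-- Insertion sort: each entry goes to the head of its block, and `shift` carries it across the
-- blocks of larger degrees.
↭-profile : ∀ {xs} → All (λ x → 1 ≤ x × x ≤ 4) xs →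
  ∃[ n₁ ] ∃[ n₂ ] ∃[ n₃ ] ∃[ n₄ ] xs ↭ profile n₁ n₂ n₃ n₄
↭-profile [] = 0 , 0 , 0 , 0 , ↭-refl
↭-profile {x ∷ _} (x-bounds ∷ bounds) with ↭-profile bounds
... | n₁ , n₂ , n₃ , n₄ , xs↭ = insert x x-bounds
  where
  fours = replicate n₄ 4
  threes = replicate n₃ 3
  twos = replicate n₂ 2
  insert : ∀ x → 1 ≤ x × x ≤ 4 → ∃[ m₁ ] ∃[ m₂ ] ∃[ m₃ ] ∃[ m₄ ] x ∷ _ ↭ profile m₁ m₂ m₃ m₄
  insert 1 _ = suc n₁ , n₂ , n₃ , n₄ , ↭-trans (prep 1 xs↭) (↭-sym
    (↭-trans (++⁺ˡ fours (++⁺ˡ threes (shift 1 twos _)))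
      (↭-trans (++⁺ˡ fours (shift 1 threes _)) (shift 1 fours _))))
  insert 2 _ = n₁ , suc n₂ , n₃ , n₄ , ↭-trans (prep 2 xs↭) (↭-sym
    (↭-trans (++⁺ˡ fours (shift 2 threes _)) (shift 2 fours _)))
  insert 3 _ = n₁ , n₂ , suc n₃ , n₄ , ↭-trans (prep 3 xs↭) (↭-sym (shift 3 fours _))
  insert 4 _ = n₁ , n₂ , n₃ , suc n₄ , prep 4 xs↭
  insert (suc (suc (suc (suc (suc _))))) (_ , s≤s (s≤s (s≤s (s≤s ()))))

-- Linear relations among the multiplicities.

-- `leaves` is the edge count solved for `n₁`; it is already substituted into `order` and `zagreb`,
-- so `n₂`, `n₃`, `n₄` act as free parameters and matching on `refl` eliminates the rest.
record Counts (n b M n₁ n₂ n₃ n₄ : ℕ) : Set where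
  field
    order     : n ≡ 2 * n₃ + 3 * n₄ + n₂ + 2
    branching : b ≡ n₃ + n₄
    leaves    : n₁ ≡ n₃ + 2 * n₄ + 2
    zagreb    : M ≡ 10 * n₃ + 18 * n₄ + 4 * n₂ + 2

-- The profile is arbitrary, so this applies both to the sorted degrees and to a prescribed extremal
-- sequence.
counts : ∀ {b} (G : Graph n) → CT* n b G → Fin n → ∀ n₁ n₂ n₃ n₄ →
  degreeSequence G ↭ profile n₁ n₂ n₃ n₄ → Counts n b (M₁ G) n₁ n₂ n₃ n₄
counts {n} G ((tree , _) , refl) r n₁ n₂ n₃ n₄ ds↭ = record
  { order     = trans order′ (trans (cong (λ m → n₄ * 1 + (n₃ * 1 + (n₂ * 1 + m * 1))) leaves)
                  (order-eq n₂ n₃ n₄))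
  -- The indicator of `2 <?_` evaluates to 1 at 4 and 3, and to 0 at 2 and 1.
  ; branching = trans (length-filter≡sum (branching? G) (allFin n))
                  (trans (sum-over (indicator (2 <?_))) (branching-eq n₁ n₂ n₃ n₄))
  ; leaves    = leaves
  ; zagreb    = trans (sum-over (_^ 2)) (trans (cong (λ m → n₄ * 16 + (n₃ * 9 + (n₂ * 4 + m * 1))) leaves)
                  (zagreb-eq n₂ n₃ n₄))
  }
  where
  open ≡-Reasoning

  -- One evaluation serves four statistics: constant 1 for the order, identity for the degree sum,
  -- square for `M₁`, indicator for branching.
  sum-over : ∀ f → sum (map (λ v → f (degree G v)) (allFin n)) ≡
    n₄ * f 4 + (n₃ * f 3 + (n₂ * f 2 + n₁ * f 1))
  sum-over f = begin
    sum (map (λ v → f (degree G v)) (allFin n)) ≡⟨ cong sum (map-∘ (allFin n)) ⟩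
    sum (map f (degreeSequence G))              ≡⟨ sum-↭ (map⁺ f ds↭) ⟩
    sum (map f (profile n₁ n₂ n₃ n₄))           ≡⟨ sum-map-profile f n₁ n₂ n₃ n₄ ⟩
    _ ∎

  order′ : n ≡ n₄ * 1 + (n₃ * 1 + (n₂ * 1 + n₁ * 1))
  order′ = begin
    n                                 ≡⟨ length-tabulate {n = n} (λ v → v) ⟨
    length (allFin n)                 ≡⟨ length≡sum (allFin n) ⟩
    sum (map (λ _ → 1) (allFin n))    ≡⟨ sum-over (λ _ → 1) ⟩
    _ ∎

  split-left : ∀ n₁ n₂ n₃ n₄ → n₁ + 2 * n₂ + 2 * n₃ + 2 * n₄ + (n₃ + 2 * n₄ + 2) ≡
    n₄ * 4 + (n₃ * 3 + (n₂ * 2 + n₁ * 1)) + 2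
  split-left = solve-∀

  split-right : ∀ n₁ n₂ n₃ n₄ → 2 * (n₄ * 1 + (n₃ * 1 + (n₂ * 1 + n₁ * 1))) ≡
    n₁ + 2 * n₂ + 2 * n₃ + 2 * n₄ + n₁
  split-right = solve-∀

  leaves : n₁ ≡ n₃ + 2 * n₄ + 2
  -- The cancelled term is the common part of the degree sum plus 2 and of twice the order.
  leaves = sym $ +-cancelˡ-≡ (n₁ + 2 * n₂ + 2 * n₃ + 2 * n₄) _ _ $ begin
    n₁ + 2 * n₂ + 2 * n₃ + 2 * n₄ + (n₃ + 2 * n₄ + 2)  ≡⟨ split-left n₁ n₂ n₃ n₄ ⟩
    n₄ * 4 + (n₃ * 3 + (n₂ * 2 + n₁ * 1)) + 2          ≡⟨ cong (_+ 2) (sum-over (λ d → d)) ⟨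
    sum (degreeSequence G) + 2                         ≡⟨ sum-degrees G tree r ⟩
    2 * n                                              ≡⟨ cong (2 *_) order′ ⟩
    2 * (n₄ * 1 + (n₃ * 1 + (n₂ * 1 + n₁ * 1)))        ≡⟨ split-right n₁ n₂ n₃ n₄ ⟩
    n₁ + 2 * n₂ + 2 * n₃ + 2 * n₄ + n₁                 ∎

  order-eq : ∀ n₂ n₃ n₄ → n₄ * 1 + (n₃ * 1 + (n₂ * 1 + (n₃ + 2 * n₄ + 2) * 1)) ≡
    2 * n₃ + 3 * n₄ + n₂ + 2
  order-eq = solve-∀

  branching-eq : ∀ n₁ n₂ n₃ n₄ → n₄ * 1 + (n₃ * 1 + (n₂ * 0 + n₁ * 0)) ≡ n₃ + n₄
  branching-eq = solve-∀

  zagreb-eq : ∀ n₂ n₃ n₄ → n₄ * 16 + (n₃ * 9 + (n₂ * 4 + (n₃ + 2 * n₄ + 2) * 1)) ≡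
    10 * n₃ + 18 * n₄ + 4 * n₂ + 2
  zagreb-eq = solve-∀

-- Distance to the two bounds, and the extremal sequences.

∸-from-≡ : ∀ {m} k l → m ≡ k + l → m ∸ k ≡ l
∸-from-≡ k l refl = m+n∸m≡n k l

-- An exact deficit yields at once the bound and its equality case, `n₃ ≡ 0`. The subtraction of 3
-- is not truncated, since `2 * n` is at least 4.
deficit₃ : ∀ {n b M n₁ n₂ n₃ n₄} → Counts n b M n₁ n₂ n₃ n₄ →
  M + 4 * n₃ ≡ 2 * (2 * n + 3 * b ∸ 3)
deficit₃ {n₂ = n₂} {n₃} {n₄} record { order = refl ; branching = refl ; zagreb = refl } =
  trans (halve n₂ n₃ n₄) (cong (2 *_) (sym (∸-from-≡ 3 _ (add-3 n₂ n₃ n₄))))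
  where
  add-3 : ∀ n₂ n₃ n₄ → 2 * (2 * n₃ + 3 * n₄ + n₂ + 2) + 3 * (n₃ + n₄) ≡
    3 + (7 * n₃ + 9 * n₄ + 2 * n₂ + 1)
  add-3 = solve-∀
  halve : ∀ n₂ n₃ n₄ → 10 * n₃ + 18 * n₄ + 4 * n₂ + 2 + 4 * n₃ ≡
    2 * (7 * n₃ + 9 * n₄ + 2 * n₂ + 1)
  halve = solve-∀

deficit₂ : ∀ {n b M n₁ n₂ n₃ n₄} → Counts n b M n₁ n₂ n₃ n₄ →
  M + 4 * n₂ ≡ 2 * (4 * n ∸ 3 * b ∸ 7)
deficit₂ {n₂ = n₂} {n₃} {n₄} record { order = refl ; branching = refl ; zagreb = refl } =
  trans (halve n₂ n₃ n₄)
    -- Once `3 * b` is removed, the remainder has the form `7 + _`, so the second subtraction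
    -- computes.
    (cong (λ m → 2 * (m ∸ 7)) (sym (∸-from-≡ (3 * (n₃ + n₄)) (7 + _) (add-3b+7 n₂ n₃ n₄))))
  where
  add-3b+7 : ∀ n₂ n₃ n₄ → 4 * (2 * n₃ + 3 * n₄ + n₂ + 2) ≡
    3 * (n₃ + n₄) + (7 + (5 * n₃ + 9 * n₄ + 4 * n₂ + 1))
  add-3b+7 = solve-∀
  halve : ∀ n₂ n₃ n₄ → 10 * n₃ + 18 * n₄ + 4 * n₂ + 2 + 4 * n₂ ≡
    2 * (5 * n₃ + 9 * n₄ + 4 * n₂ + 1)
  halve = solve-∀

-- With `n₃` zero, `branching` gives `n₄`, then `order` gives `n₂` and `leaves` gives `n₁`.
profile-without-3 : ∀ {n b M n₁ n₂ n₃ n₄} → Counts n b M n₁ n₂ n₃ n₄ → n₃ ≡ 0 →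
  profile n₁ n₂ n₃ n₄ ≡ replicate b 4 ++ replicate (n ∸ 3 * b ∸ 2) 2 ++ replicate (2 * b + 2) 1
profile-without-3 {n₂ = n₂} {n₄ = n₄} record { order = refl ; branching = refl ; leaves = refl } refl =
  cong (λ m → replicate n₄ 4 ++ replicate (m ∸ 2) 2 ++ replicate (2 * n₄ + 2) 1)
    (sym (∸-from-≡ (3 * n₄) (2 + n₂) (add-2 n₂ n₄)))
  where
  add-2 : ∀ n₂ n₄ → 3 * n₄ + n₂ + 2 ≡ 3 * n₄ + (2 + n₂)
  add-2 = solve-∀

-- With `n₂` zero, `order` and `branching` determine `n₃` and `n₄`. Adding 2 before subtracting `n`
-- matters: `3 * b` may be smaller than `n`.
profile-without-2 : ∀ {n b M n₁ n₂ n₃ n₄} → Counts n b M n₁ n₂ n₃ n₄ → n₂ ≡ 0 →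
  profile n₁ n₂ n₃ n₄ ≡
    replicate (n ∸ 2 * b ∸ 2) 4 ++ replicate (3 * b + 2 ∸ n) 3 ++ replicate (n ∸ b) 1
profile-without-2 {n₃ = n₃} {n₄} record { order = refl ; branching = refl ; leaves = refl } refl =
  cong₂ _++_ (cong (λ m → replicate (m ∸ 2) 4) (sym (∸-from-≡ (2 * (n₃ + n₄)) (2 + n₄) (fours n₃ n₄))))
    (cong₂ (λ k l → replicate k 3 ++ replicate l 1)
      (sym (∸-from-≡ (2 * n₃ + 3 * n₄ + 0 + 2) n₃ (threes n₃ n₄)))
      (sym (∸-from-≡ (n₃ + n₄) (n₃ + 2 * n₄ + 2) (ones n₃ n₄))))
  where
  fours : ∀ n₃ n₄ → 2 * n₃ + 3 * n₄ + 0 + 2 ≡ 2 * (n₃ + n₄) + (2 + n₄)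
  fours = solve-∀
  threes : ∀ n₃ n₄ → 3 * (n₃ + n₄) + 2 ≡ 2 * n₃ + 3 * n₄ + 0 + 2 + n₃
  threes = solve-∀
  ones : ∀ n₃ n₄ → 2 * n₃ + 3 * n₄ + 0 + 2 ≡ n₃ + n₄ + (n₃ + 2 * n₄ + 2)
  ones = solve-∀

no-deficit : ∀ {m k N} → m + 4 * k ≡ N → m ≡ N → k ≡ 0
no-deficit {m} {k} m+4k≡N m≡N =
  -- `4 * k` unfolds to `k + 3 * k`, so its vanishing forces that of `k`.
  m+n≡0⇒m≡0 k (+-cancelˡ-≡ m _ _ (trans m+4k≡N (trans (sym m≡N) (sym (+-identityʳ m)))))

theorem3 : (n b : ℕ) → 1 ≤ b → 2 * b + 2 < n →
    (BT : Graph n) → CT* n b BT →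
    (3 * b + 2 < n →
    M₁ BT ≤ 2 * (2 * n + 3 * b ∸ 3) ×
    (M₁ BT ≡ 2 * (2 * n + 3 * b ∸ 3) ⇔
    (degreeSequence BT ↭
    replicate b 4 ++ replicate (n ∸ 3 * b ∸ 2) 2 ++ replicate (2 * b + 2) 1))) ×
    (n ≤ 3 * b + 2 →
    M₁ BT ≤ 2 * (4 * n ∸ 3 * b ∸ 7) ×
    (M₁ BT ≡ 2 * (4 * n ∸ 3 * b ∸ 7) ⇔
    (degreeSequence BT ↭
    replicate (n ∸ 2 * b ∸ 2) 4 ++ replicate (3 * b + 2 ∸ n) 3 ++ replicate (n ∸ b) 1)))
theorem3 (suc n) b _ 2b+2<n BT BT∈@(((conn , _) , degree≤4) , _)
  with ↭-profile (All-map⁺ (All.universal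
    -- From `2 * b + 2 < suc n` there are at least two vertices, so connectedness excludes degree 0.
    (λ v → connected⇒1≤degree BT (≤-trans (m≤n+m 2 (suc (2 * b))) 2b+2<n) conn v , degree≤4 v)
    (allFin (suc n))))
... | n₁ , n₂ , n₃ , n₄ , ds↭ =
  (λ _ → ≤-trans (m≤m+n _ (4 * n₃)) (≤-reflexive (deficit₃ c)) , mk⇔
    (λ eq → subst (degreeSequence BT ↭_) (profile-without-3 c (no-deficit {k = n₃} (deficit₃ c) eq)) ds↭)
    -- Conversely, the extremal sequence is itself a profile with `n₃` equal to 0, its empty block
    -- of threes vanishing by computation; the deficit is then 0. The second case does the same with
    -- `n₂`.
    (λ p → trans (sym (+-identityʳ _)) (deficit₃
      (counts BT BT∈ zero (2 * b + 2) (suc n ∸ 3 * b ∸ 2) 0 b p)))) ,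
  (λ _ → ≤-trans (m≤m+n _ (4 * n₂)) (≤-reflexive (deficit₂ c)) , mk⇔
    (λ eq → subst (degreeSequence BT ↭_) (profile-without-2 c (no-deficit {k = n₂} (deficit₂ c) eq)) ds↭)
    (λ p → trans (sym (+-identityʳ _)) (deficit₂
      (counts BT BT∈ zero (suc n ∸ b) 0 (3 * b + 2 ∸ suc n) (suc n ∸ 2 * b ∸ 2) p))))
  where
  c : Counts (suc n) b (M₁ BT) n₁ n₂ n₃ n₄
  c = counts BT BT∈ zero n₁ n₂ n₃ n₄ ds↭
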